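{- Let $\mathcal L$ be a cubic algebra, $\mathsf I$ a special subalgebra of $\mathcal L$ and $g\in\mathcal L$. Then $\mathsf I_g=\{\Delta(g\vee f,f): f\in\mathsf I\}$ is a special subalgebra of $\mathcal L$, and $[\![\mathsf I_g]\!]=[\![\mathsf I]\!]$.
   Context: A cubic algebra is a join-semilattice $\mathcal L$ with top $\mathbf 1$ and a binary operation $\Delta$ such that: if $x\le y$ then $\Delta(y,x)\vee x=y$; if $x\le y\le z$ then $\Delta(z,\Delta(y,x))=\Delta(\Delta(z,y),\Delta(z,x))$; if $x\le y$ then $\Delta(y,\Delta(y,x))=x$; if $x\le y\le z$ then $\Delta(z,x)\le\Delta(z,y)$; and with $xy:=\Delta(\mathbf 1,\Delta(x\vee y,y))\vee y$ one has $(xy)y=x\vee y$ and $x(yz)=y(xz)$. With $xy$, $\mathcal L$ is an implication algebra; an implication subalgebra is a subset closed under it. For $X\subseteq\mathcal L$, $[\![X]\!]$ denotes the cubic subalgebra generated by $X$ (closure under $\vee$, $\Delta$, containing $\mathbf 1$). A subset $A\subseteq\mathcal L$ is compatible iff for every embedding $e$ of $\mathcal L$ into an interval algebra of a Boolean algebra, $e[A]$ has the finite intersection property; equivalently, $x\vee\Delta(\mathbf 1,y)=\mathbf 1$ for all $x,y\in A$. A special subalgebra of $\mathcal L$ is an upwards-closed implication subalgebra $I$ that is compatible and such that for all $x,y\in I$, if $x\wedge y$ exists in $\mathcal L$ then $x\wedge y\in I$. -}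

module Defs where

open import Level using (Level; _⊔_; suc)
open import Relation.Binary.PropositionalEquality using (_≡_)
open import Data.Product using (Σ; ∃; _×_)
open import Relation.Unary using (Pred; _∈_; _⊆_)

record CubicAlgebra (a : Level) : Set (suc a) where
  infixr 6 _∨_
  infix 4 _≤_
  field
    Carrier : Set a
    _∨_     : Carrier → Carrier → Carrier
    𝟏       : Carrier
    Δ       : Carrier → Carrier → Carrier
    ∨-assoc : ∀ x y z → (x ∨ y) ∨ z ≡ x ∨ (y ∨ z)
    ∨-comm  : ∀ x y → x ∨ y ≡ y ∨ x
    ∨-idem  : ∀ x → x ∨ x ≡ x
    ∨-top   : ∀ x → x ∨ 𝟏 ≡ 𝟏

  _≤_ : Carrier → Carrier → Set a
  x ≤ y = x ∨ y ≡ y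

  _⇒_ : Carrier → Carrier → Carrier
  x ⇒ y = Δ 𝟏 (Δ (x ∨ y) y) ∨ y

  field
    ax1 : ∀ x y → x ≤ y → Δ y x ∨ x ≡ y
    ax2 : ∀ x y z → x ≤ y → y ≤ z → Δ z (Δ y x) ≡ Δ (Δ z y) (Δ z x)
    ax3 : ∀ x y → x ≤ y → Δ y (Δ y x) ≡ x
    ax4 : ∀ x y z → x ≤ y → y ≤ z → Δ z x ≤ Δ z y
    ax5 : ∀ x y → (x ⇒ y) ⇒ y ≡ x ∨ y
    ax6 : ∀ x y z → x ⇒ (y ⇒ z) ≡ y ⇒ (x ⇒ z)

module _ {a : Level} (L : CubicAlgebra a) where
  open CubicAlgebra L

  IsMeet : Carrier → Carrier → Carrier → Set a
  IsMeet x y z = z ≤ x × z ≤ y × (∀ w → w ≤ x → w ≤ y → w ≤ z)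

  UpClosed : Pred Carrier a → Set a
  UpClosed I = ∀ {x y} → x ∈ I → x ≤ y → y ∈ I

  ImplicationSubalgebra : Pred Carrier a → Set a
  ImplicationSubalgebra I = ∀ {x y} → x ∈ I → y ∈ I → (x ⇒ y) ∈ I

  -- compatibility, in the algebraic form given in the paper:
  -- x ∨ Δ(𝟏, y) = 𝟏 for all x, y ∈ A
  Compatible : Pred Carrier a → Set a
  Compatible A = ∀ {x y} → x ∈ A → y ∈ A → x ∨ Δ 𝟏 y ≡ 𝟏

  MeetClosed : Pred Carrier a → Set a
  MeetClosed I = ∀ {x y z} → x ∈ I → y ∈ I → IsMeet x y z → z ∈ I

  record Special (I : Pred Carrier a) : Set a where
    field
      upClosed   : UpClosed I
      implSub    : ImplicationSubalgebra I
      compatible : Compatible I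
      meetClosed : MeetClosed I

  data ⟦_⟧ (X : Pred Carrier a) : Pred Carrier a where
    gen : ∀ {x} → x ∈ X → x ∈ ⟦ X ⟧
    top : 𝟏 ∈ ⟦ X ⟧
    join : ∀ {x y} → x ∈ ⟦ X ⟧ → y ∈ ⟦ X ⟧ → (x ∨ y) ∈ ⟦ X ⟧
    delta : ∀ {x y} → x ∈ ⟦ X ⟧ → y ∈ ⟦ X ⟧ → Δ x y ∈ ⟦ X ⟧

  Shift : Pred Carrier a → Carrier → Pred Carrier a
  Shift I g h = Σ Carrier (λ f → f ∈ I × h ≡ Δ (g ∨ f) f)

{-# OPTIONS --safe #-}
-- In a cubic algebra, (L, ⇒) is an implication algebra, and the key inequality is
--   x ≤ y, x ≤ k  ⟹  Δ(y, x) ≤ Δ(y ∨ k, k)                          (Δ-mono₂)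
-- It says that reflecting in y extends to a monotone map k ↦ Δ(y ∨ k, k) above x.
-- Upward closure of I_g: if Δ(y, f) ≤ k with y = g ∨ f, then k = Δ(g ∨ f', f') for
-- f' = Δ(y ∨ k, k), and f ≤ f'.  Closure under ⇒ follows, since x ⇒ y ≥ y.
-- Compatibility: upward closure reduces it to showing that w = 𝟏 when both w and
-- Δ(𝟏, w) lie in I_g.
-- Meets: if m is the meet of Δ(pᵢ, fᵢ) with pᵢ = g ∨ fᵢ, then v = p₁ ∧ p₂ exists and
-- e = Δ(v, m) is the meet of f₁ and f₂, with g ∨ e = v, so m = Δ(g ∨ e, e).
module Submission where

open import Defs
open import Level using (Level)
open import Data.Product using (_×_; _,_; proj₁; proj₂)
open import Relation.Binary.PropositionalEquality
  using (_≡_; refl; sym; trans; cong; cong₂; subst; subst₂; module ≡-Reasoning)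
open import Relation.Unary using (Pred; _∈_; _⊆_)

module CubicAlgebraProperties {a : Level} (L : CubicAlgebra a) where
  open CubicAlgebra L
  open ≡-Reasoning

  private variable
    b c k m p q u v x y z : Carrier

  -- Order and reflections.

  ≤-refl : x ≤ x
  ≤-refl = ∨-idem _

  ≤-reflexive : x ≡ y → x ≤ y
  ≤-reflexive refl = ≤-refl

  ≤-trans : x ≤ y → y ≤ z → x ≤ z
  ≤-trans {x} {y} {z} x≤y y≤z = begin
    x ∨ z        ≡⟨ cong (x ∨_) (sym y≤z) ⟩
    x ∨ (y ∨ z)  ≡⟨ sym (∨-assoc x y z) ⟩
    (x ∨ y) ∨ z  ≡⟨ cong (_∨ z) x≤y ⟩
    y ∨ z        ≡⟨ y≤z ⟩
    z            ∎

  ≤-antisym : x ≤ y → y ≤ x → x ≡ y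
  ≤-antisym x≤y y≤x = trans (sym y≤x) (trans (∨-comm _ _) x≤y)

  x≤x∨y : x ≤ x ∨ y
  x≤x∨y {x} {y} = trans (sym (∨-assoc x x y)) (cong (_∨ y) (∨-idem x))

  y≤x∨y : y ≤ x ∨ y
  y≤x∨y {y} {x} = subst (y ≤_) (∨-comm y x) x≤x∨y

  ∨-least : x ≤ z → y ≤ z → x ∨ y ≤ z
  ∨-least x≤z y≤z = trans (∨-assoc _ _ _) (trans (cong (_ ∨_) y≤z) x≤z)

  ∨-mono : x ≤ y → u ≤ v → x ∨ u ≤ y ∨ v
  ∨-mono x≤y u≤v = ∨-least (≤-trans x≤y x≤x∨y) (≤-trans u≤v y≤x∨y)

  x≤𝟏 : x ≤ 𝟏
  x≤𝟏 = ∨-top _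

  𝟏≤x⇒x≡𝟏 : 𝟏 ≤ x → x ≡ 𝟏
  𝟏≤x⇒x≡𝟏 = ≤-antisym x≤𝟏

  Δ≤ : x ≤ y → Δ y x ≤ y
  Δ≤ x≤y = subst (Δ _ _ ≤_) (ax1 _ _ x≤y) x≤x∨y

  Δ-self : Δ x x ≡ x
  Δ-self {x} = ≤-antisym (Δ≤ ≤-refl)
    (subst (_≤ Δ x x) (ax3 x x ≤-refl) (ax4 _ _ _ (Δ≤ ≤-refl) ≤-refl))

  -- `Δ z` is a monotone involution below `z`, so it can be moved across an inequality.
  Δ-swap : x ≤ z → Δ z x ≤ y → y ≤ z → x ≤ Δ z y
  Δ-swap x≤z Δzx≤y y≤z = subst (_≤ _) (ax3 _ _ x≤z) (ax4 _ _ _ Δzx≤y y≤z)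

  Δ≡⇒≡Δ : x ≤ y → z ≡ Δ y x → x ≡ Δ y z
  Δ≡⇒≡Δ x≤y z≡Δ = trans (sym (ax3 _ _ x≤y)) (cong (Δ _) (sym z≡Δ))

  -- Implication algebra, with meets above a common lower bound.

  y≤x⇒y : y ≤ x ⇒ y
  y≤x⇒y = y≤x∨y

  ≤⇒⇒≡𝟏 : x ≤ y → x ⇒ y ≡ 𝟏
  ≤⇒⇒≡𝟏 {x} {y} x≤y = begin
    Δ 𝟏 (Δ (x ∨ y) y) ∨ y  ≡⟨ cong (λ t → Δ 𝟏 (Δ t y) ∨ y) x≤y ⟩
    Δ 𝟏 (Δ y y) ∨ y        ≡⟨ cong (λ t → Δ 𝟏 t ∨ y) Δ-self ⟩
    Δ 𝟏 y ∨ y              ≡⟨ ax1 y 𝟏 x≤𝟏 ⟩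
    𝟏                      ∎

  𝟏⇒ : 𝟏 ⇒ x ≡ x
  𝟏⇒ {x} = begin
    𝟏 ⇒ x        ≡⟨ cong (_⇒ x) (sym (≤⇒⇒≡𝟏 ≤-refl)) ⟩
    (x ⇒ x) ⇒ x  ≡⟨ ax5 x x ⟩
    x ∨ x        ≡⟨ ∨-idem x ⟩
    x            ∎

  ⇒≡𝟏⇒≤ : x ⇒ y ≡ 𝟏 → x ≤ y
  ⇒≡𝟏⇒≤ eq = trans (sym (ax5 _ _)) (trans (cong (_⇒ _) eq) 𝟏⇒)

  ⇒-exchange : x ≤ y ⇒ z → y ≤ x ⇒ z
  ⇒-exchange x≤y⇒z = ⇒≡𝟏⇒≤ (trans (ax6 _ _ _) (≤⇒⇒≡𝟏 x≤y⇒z))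

  ⇒-antitoneˡ : x ≤ y → y ⇒ z ≤ x ⇒ z
  ⇒-antitoneˡ x≤y = ⇒-exchange (subst (_ ≤_) (sym (ax5 _ _)) (≤-trans x≤y x≤x∨y))

  ⇒-monoʳ : y ≤ z → x ⇒ y ≤ x ⇒ z
  ⇒-monoʳ {y} {z} {x} y≤z = subst (x ⇒ y ≤_) eq y≤x⇒y
    where
    eq : (z ⇒ y) ⇒ (x ⇒ y) ≡ x ⇒ z
    eq = begin
      (z ⇒ y) ⇒ (x ⇒ y)  ≡⟨ ax6 _ _ _ ⟩
      -- Exhibits `x ⇒ z` as an implication with consequent `x ⇒ y`, hence above it.
      x ⇒ ((z ⇒ y) ⇒ y)  ≡⟨ cong (x ⇒_) (ax5 z y) ⟩
      x ⇒ (z ∨ y)        ≡⟨ cong (x ⇒_) (trans (∨-comm z y) y≤z) ⟩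
      x ⇒ z              ∎

  x∨[x⇒y]≡𝟏 : x ∨ (x ⇒ y) ≡ 𝟏
  x∨[x⇒y]≡𝟏 {x} {y} = 𝟏≤x⇒x≡𝟏 (subst (_≤ x ∨ (x ⇒ y)) (ax1 _ 𝟏 x≤𝟏)
    (∨-least (≤-trans x≤x∨y y≤x∨y)
             (≤-trans (Δ≤ y≤x∨y) (∨-mono ≤-refl y≤x⇒y))))

  ⇒-contract : x ≤ x ⇒ y → x ≤ y
  ⇒-contract x≤x⇒y = ⇒≡𝟏⇒≤ (trans (sym x≤x⇒y) x∨[x⇒y]≡𝟏)

  -- Both `y` and `k` lie below `c ⇒ k`, hence so does `c`; then contract.
  cut : c ≤ y ∨ k → c ≤ y ⇒ k → c ≤ k
  cut c≤y∨k c≤y⇒k =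
    ⇒-contract (≤-trans c≤y∨k (∨-least (⇒-exchange c≤y⇒k) y≤x⇒y))

  -- In the Boolean interval from `z` to `𝟏`, `x ⇒ z` is the complement of `x`; the formula is the
  -- complement of "`p` implies not `q`".
  meet : Carrier → Carrier → Carrier → Carrier
  meet z p q = (p ⇒ (q ⇒ z)) ⇒ z

  meet-isMeet : z ≤ p → z ≤ q → IsMeet L p q (meet z p q)
  meet-isMeet {z} {p} {q} z≤p z≤q =
      below z≤p (⇒-monoʳ y≤x⇒y)
    , below z≤q y≤x⇒y
    , λ w w≤p w≤q → ⇒-exchange (≤-trans (⇒-antitoneˡ w≤p)
        (≤-trans (⇒-monoʳ (⇒-antitoneˡ w≤q)) (⇒-collapse w)))
    where
    below : z ≤ x → x ⇒ z ≤ y → y ⇒ z ≤ x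
    below z≤x x⇒z≤y = ≤-trans (⇒-antitoneˡ x⇒z≤y)
      (≤-reflexive (trans (ax5 _ _) (trans (∨-comm _ _) z≤x)))
    ⇒-collapse : ∀ w → w ⇒ (w ⇒ z) ≤ w ⇒ z
    ⇒-collapse w = ⇒-exchange (⇒-contract (subst (w ≤_) (ax6 _ _ _) (⇒-exchange ≤-refl)))

  -- With `n` as below, `n ⇒ m` is `meet m p q`, a lower bound of `p` and `q`, so it is below `m`;
  -- this forces `n` to be `𝟏`.
  meet-residual : IsMeet L p q m → p ≤ q ⇒ m
  meet-residual {p} {q} {m} (m≤p , m≤q , greatest) = ⇒≡𝟏⇒≤ (begin
    n            ≡⟨ sym m≤n ⟩
    m ∨ n        ≡⟨ ∨-comm m n ⟩
    n ∨ m        ≡⟨ sym (ax5 n m) ⟩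
    (n ⇒ m) ⇒ m  ≡⟨ ≤⇒⇒≡𝟏 (greatest _ (proj₁ isMeet) (proj₁ (proj₂ isMeet))) ⟩
    𝟏            ∎)
    where
    n = p ⇒ (q ⇒ m)
    m≤n : m ≤ n
    m≤n = ≤-trans y≤x⇒y y≤x⇒y
    isMeet = meet-isMeet m≤p m≤q

  -- Distributivity of join over an existing meet, phrased without the meet of `p ∨ b` and `q ∨ b`.
  meet-distrib : IsMeet L p q m → m ≤ b → x ≤ p ∨ b → x ≤ q ∨ b → x ≤ b
  meet-distrib isMeet m≤b x≤p∨b x≤q∨b = cut x≤q∨b
    (≤-trans x≤p∨b (∨-least (≤-trans (meet-residual isMeet) (⇒-monoʳ m≤b)) y≤x⇒y))

  IsMeet-sym : IsMeet L p q m → IsMeet L q p m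
  IsMeet-sym (m≤p , m≤q , greatest) = m≤q , m≤p , λ w w≤q w≤p → greatest w w≤p w≤q

  -- The key inequality for reflections.

  Δ𝟏Δ≤ : x ≤ y → y ≤ z → Δ 𝟏 (Δ z x) ≤ Δ 𝟏 (Δ y x) ∨ x
  Δ𝟏Δ≤ {x} {y} {z} x≤y y≤z = subst₂ (λ s t → Δ 𝟏 (Δ s x) ≤ Δ 𝟏 (Δ t x) ∨ x)
    (trans (∨-comm z x) (≤-trans x≤y y≤z)) (trans (∨-comm y x) x≤y)
    -- This is `z ⇒ x ≤ y ⇒ x` unfolded, keeping one joinand on the left.
    (≤-trans x≤x∨y (⇒-antitoneˡ y≤z))

  -- Here `s` is `y ⇒ d` and `t` is `y ⇒ x`. Antitonicity of `⇒` at `d` gives `Δ z d ≤ Δ 𝟏 s`, and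
  -- `s ≤ Δ 𝟏 t` joinand by joinand.
  ΔΔ≤⇒ : x ≤ y → y ≤ z → Δ z (Δ y x) ≤ y ⇒ x
  ΔΔ≤⇒ {x} {y} {z} x≤y y≤z = subst (Δ z d ≤_) (sym y⇒x≡t)
      (≤-trans Δzd≤Δ𝟏s (subst (Δ 𝟏 s ≤_) (ax3 t 𝟏 x≤𝟏) (ax4 _ _ _ s≤Δ𝟏t x≤𝟏)))
    where
    d = Δ y x
    s = Δ 𝟏 x ∨ d
    t = Δ 𝟏 d ∨ x
    y⇒x≡t : y ⇒ x ≡ t
    y⇒x≡t = cong (λ v → Δ 𝟏 (Δ v x) ∨ x) (trans (∨-comm y x) x≤y)
    Δzd≤Δ𝟏s : Δ z d ≤ Δ 𝟏 s
    Δzd≤Δ𝟏s = Δ-swap x≤𝟏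
      (subst (λ v → Δ 𝟏 (Δ z d) ≤ Δ 𝟏 v ∨ d) (ax3 _ _ x≤y) (Δ𝟏Δ≤ (Δ≤ x≤y) y≤z)) x≤𝟏
    s≤Δ𝟏t : s ≤ Δ 𝟏 t
    s≤Δ𝟏t = ∨-least (ax4 _ _ _ y≤x∨y x≤𝟏) (Δ-swap x≤𝟏 x≤x∨y x≤𝟏)

  Δ-mono₂ : x ≤ y → x ≤ k → Δ y x ≤ Δ (y ∨ k) k
  Δ-mono₂ x≤y x≤k = Δ-swap Δyx≤y∨k
    -- After swapping, the goal is `Δ (y ∨ k) (Δ y x) ≤ k`, obtained by cutting on `y`.
    (cut (Δ≤ Δyx≤y∨k) (≤-trans (ΔΔ≤⇒ x≤y x≤x∨y) (⇒-monoʳ x≤k))) y≤x∨y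
    where Δyx≤y∨k = ≤-trans (Δ≤ x≤y) x≤x∨y

  ∨-Δ-absorb : x ≤ y → x ≤ k → y ∨ Δ (y ∨ k) k ≡ y ∨ k
  ∨-Δ-absorb {x} {y} {k} x≤y x≤k = ≤-antisym t≤s
      (subst (s ≤_) (ax3 t s t≤s) (Δ-swap ≤-refl (subst (_≤ Δ s t) (sym Δ-self) s≤Δst) (Δ≤ t≤s)))
    where
    s = y ∨ k
    t = y ∨ Δ s k
    t≤s : t ≤ s
    t≤s = ∨-least x≤x∨y (Δ≤ y≤x∨y)
    s≤Δst : s ≤ Δ s t
    -- Split `s` as `Δ s x ∨ x`: the first part uses `x ≤ t`, the second `x ≤ k ≤ Δ s t`.
    s≤Δst = subst (_≤ Δ s t) (ax1 x s (≤-trans x≤y x≤x∨y))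
      (∨-least (ax4 _ _ _ (≤-trans x≤y x≤x∨y) t≤s)
               (≤-trans x≤k (Δ-swap y≤x∨y y≤x∨y t≤s)))

module ShiftProperties {a : Level} (L : CubicAlgebra a)
  (I : Pred (CubicAlgebra.Carrier L) a) (g : CubicAlgebra.Carrier L) (special : Special L I) where
  open CubicAlgebra L
  open CubicAlgebraProperties L
  open Special special

  private variable
    f t w z : Carrier

  -- Upward closure of the shift.

  ∨-mem : f ∈ I → g ∨ f ∈ I
  ∨-mem f∈I = upClosed f∈I y≤x∨y

  shift-mem : f ∈ I → Δ (g ∨ f) f ∈ Shift L I g
  shift-mem f∈I = _ , f∈I , refl

  shift≤ : Δ (g ∨ f) f ≤ g ∨ f
  shift≤ = Δ≤ y≤x∨y

  shift-involutive : Δ (g ∨ f) (Δ (g ∨ f) f) ≡ f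
  shift-involutive = ax3 _ _ y≤x∨y

  shift-upClosed : UpClosed L (Shift L I g)
  shift-upClosed {y = k} (f , f∈I , refl) h≤k =
    f′ , upClosed f∈I f≤f′ , subst (λ v → k ≡ Δ v f′) (sym g∨f′≡y∨k) (sym (ax3 _ _ y≤x∨y))
    where
    y = g ∨ f
    f′ = Δ (y ∨ k) k
    f≤f′ : f ≤ f′
    f≤f′ = subst (_≤ f′) shift-involutive (Δ-mono₂ shift≤ h≤k)
    -- Hence the shift of `f′` reflects in the same element that defined `f′`, and returns `k`.
    g∨f′≡y∨k : g ∨ f′ ≡ y ∨ k
    g∨f′≡y∨k = begin
      g ∨ f′        ≡⟨ cong (g ∨_) (sym f≤f′) ⟩
      g ∨ (f ∨ f′)  ≡⟨ sym (∨-assoc g f f′) ⟩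
      y ∨ f′        ≡⟨ ∨-Δ-absorb shift≤ h≤k ⟩
      y ∨ k         ∎
      where open ≡-Reasoning

  -- Compatibility of the shift.

  antipodal-shift≡𝟏 : w ∈ Shift L I g → Δ 𝟏 w ∈ Shift L I g → w ≡ 𝟏
  antipodal-shift≡𝟏 {w} (f , f∈I , w≡) (f′ , f′∈I , w′≡) = begin
      w           ≡⟨ sym (∨-idem w) ⟩
      w ∨ w       ≡⟨ cong₂ _∨_ (sym f′≡w) (sym (trans (cong (Δ 𝟏) f≡w′) (ax3 w 𝟏 x≤𝟏))) ⟩
      f′ ∨ Δ 𝟏 f  ≡⟨ compatible f′∈I f∈I ⟩
      𝟏           ∎
    where
    open ≡-Reasoning
    w′ = Δ 𝟏 w
    p = g ∨ f
    q = g ∨ f′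
    w≤p : w ≤ p
    w≤p = ≤-trans (≤-reflexive w≡) shift≤
    w′≤q : w′ ≤ q
    w′≤q = ≤-trans (≤-reflexive w′≡) shift≤
    f≡ : f ≡ Δ p w
    f≡ = Δ≡⇒≡Δ y≤x∨y w≡
    f′≡ : f′ ≡ Δ q w′
    f′≡ = Δ≡⇒≡Δ y≤x∨y w′≡
    -- Apply `Δ-mono₂` to `w ≤ Δ 𝟏 q`; compatibility of `I` turns the join `p ∨ Δ 𝟏 q` into `𝟏`.
    f≤q : f ≤ q
    f≤q = subst₂ _≤_ (sym f≡)
      (trans (cong (λ v → Δ v (Δ 𝟏 q)) (compatible (∨-mem f∈I) (∨-mem f′∈I))) (ax3 q 𝟏 x≤𝟏))
      (Δ-mono₂ w≤p (Δ-swap x≤𝟏 w′≤q x≤𝟏))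
    f′≤p : f′ ≤ p
    f′≤p = subst₂ _≤_ (sym f′≡)
      (trans (cong (λ v → Δ v (Δ 𝟏 p)) (compatible (∨-mem f′∈I) (∨-mem f∈I))) (ax3 p 𝟏 x≤𝟏))
      (Δ-mono₂ w′≤q (ax4 _ _ _ w≤p x≤𝟏))
    p≡q : p ≡ q
    p≡q = ≤-antisym (∨-least x≤x∨y f≤q) (∨-least x≤x∨y f′≤p)
    p≡𝟏 : p ≡ 𝟏
    p≡𝟏 = 𝟏≤x⇒x≡𝟏 (subst (_≤ p) (ax1 w 𝟏 x≤𝟏)
      (∨-least (subst (w′ ≤_) (sym p≡q) w′≤q) w≤p))
    f≡w′ : f ≡ w′
    f≡w′ = trans f≡ (cong (λ v → Δ v w) p≡𝟏)
    f′≡w : f′ ≡ w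
    f′≡w = trans f′≡ (trans (cong (λ v → Δ v w′) (trans (sym p≡q) p≡𝟏)) (ax3 w 𝟏 x≤𝟏))

  shift-compatible : Compatible L (Shift L I g)
  -- Take `w = x ∨ Δ 𝟏 y`: it is above `x`, and its antipode is above `y`.
  shift-compatible x∈ y∈ = antipodal-shift≡𝟏
    (shift-upClosed x∈ x≤x∨y)
    (shift-upClosed y∈ (Δ-swap x≤𝟏 y≤x∨y x≤𝟏))

  -- Meets in the shift.

  ≤-of-Δ-mem : t ≤ z → t ∈ I → Δ z t ∈ I → z ≤ t
  ≤-of-Δ-mem {t} {z} t≤z t∈I Δzt∈I = ⇒≡𝟏⇒≤ (begin
    Δ 𝟏 (Δ (z ∨ t) t) ∨ t  ≡⟨ cong (λ v → Δ 𝟏 (Δ v t) ∨ t) (trans (∨-comm z t) t≤z) ⟩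
    Δ 𝟏 (Δ z t) ∨ t        ≡⟨ ∨-comm _ t ⟩
    t ∨ Δ 𝟏 (Δ z t)        ≡⟨ compatible t∈I Δzt∈I ⟩
    𝟏                      ∎)
    where open ≡-Reasoning

  -- Reflecting `t` in `(g ∨ f) ∨ t` gives an element above `f`, hence in `I`; compatibility then
  -- collapses the join to `t`.
  ∨≤-of-shift≤ : f ∈ I → Δ (g ∨ f) f ≤ t → t ∈ I → g ∨ f ≤ t
  ∨≤-of-shift≤ {f} {t} f∈I h≤t t∈I = ≤-trans x≤x∨y (≤-of-Δ-mem y≤x∨y t∈I
    (upClosed f∈I (subst (_≤ Δ ((g ∨ f) ∨ t) t) shift-involutive (Δ-mono₂ shift≤ h≤t))))

  module _ {f₁ f₂ m : Carrier} (f₁∈I : f₁ ∈ I) (f₂∈I : f₂ ∈ I)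
    (isMeet : IsMeet L (Δ (g ∨ f₁) f₁) (Δ (g ∨ f₂) f₂) m) where

    private
      p₁ p₂ h₁ h₂ : Carrier
      p₁ = g ∨ f₁
      p₂ = g ∨ f₂
      h₁ = Δ p₁ f₁
      h₂ = Δ p₂ f₂
      m≤h₁ : m ≤ h₁
      m≤h₁ = proj₁ isMeet
      m≤h₂ : m ≤ h₂
      m≤h₂ = proj₁ (proj₂ isMeet)
      m≤p₁ : m ≤ p₁
      m≤p₁ = ≤-trans m≤h₁ shift≤
      m≤p₂ : m ≤ p₂
      m≤p₂ = ≤-trans m≤h₂ shift≤
      v e : Carrier
      v = meet m p₁ p₂
      e = Δ v m
      v-isMeet : IsMeet L p₁ p₂ v
      v-isMeet = meet-isMeet m≤p₁ m≤p₂
      v≤p₁ : v ≤ p₁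
      v≤p₁ = proj₁ v-isMeet
      v≤p₂ : v ≤ p₂
      v≤p₂ = proj₁ (proj₂ v-isMeet)
      g≤v : g ≤ v
      g≤v = proj₂ (proj₂ v-isMeet) g x≤x∨y x≤x∨y
      m≤v : m ≤ v
      m≤v = proj₂ (proj₂ v-isMeet) m m≤p₁ m≤p₂
      e≤v : e ≤ v
      e≤v = Δ≤ m≤v

      Δv≤ : ∀ {q f} → IsMeet L (g ∨ f) q v → q ∈ I → f ∈ I → m ≤ Δ (g ∨ f) f → Δ v m ≤ f
      Δv≤ {q} {f} v-meet q∈I f∈I m≤h =
        subst (Δ v m ≤_) shift-involutive
          (subst (λ s → Δ v m ≤ Δ s h) v∨h≡p (Δ-mono₂ m≤v m≤h))
        where
        p = g ∨ f
        h = Δ p f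
        p≤q∨h : p ≤ q ∨ h
        p≤q∨h = ∨≤-of-shift≤ f∈I y≤x∨y (upClosed q∈I x≤x∨y)
        v∨h≡p : v ∨ h ≡ p
        v∨h≡p = ≤-antisym (∨-least (proj₁ v-meet) shift≤)
          -- As `v` is the meet of `p` and `q`, distributivity turns `p ≤ q ∨ h` into `p ≤ v ∨ h`.
          (meet-distrib v-meet x≤x∨y x≤x∨y (≤-trans p≤q∨h (∨-mono ≤-refl y≤x∨y)))

      e≤f₁ : e ≤ f₁
      e≤f₁ = Δv≤ v-isMeet (∨-mem f₂∈I) f₁∈I m≤h₁
      e≤f₂ : e ≤ f₂
      e≤f₂ = Δv≤ (IsMeet-sym v-isMeet) (∨-mem f₁∈I) f₂∈I m≤h₂

      Δv-mono : ∀ {x f} → x ≤ v → x ≤ f → v ≤ g ∨ f → Δ v x ≤ Δ (g ∨ f) f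
      Δv-mono {x} {f} x≤v x≤f v≤g∨f = subst (λ s → Δ v x ≤ Δ s f)
        (≤-antisym (∨-least v≤g∨f y≤x∨y) (∨-mono g≤v ≤-refl))
        (Δ-mono₂ x≤v x≤f)

      e-isMeet : IsMeet L f₁ f₂ e
      e-isMeet = e≤f₁ , e≤f₂ , λ w w≤f₁ w≤f₂ →
        let w≤v = proj₂ (proj₂ v-isMeet) w (≤-trans w≤f₁ y≤x∨y) (≤-trans w≤f₂ y≤x∨y)
        -- `Δ v w` lies below both `h₁` and `h₂`, hence below `m`; reflecting back in `v` gives
        -- `w ≤ e`.
        in Δ-swap w≤v
          (proj₂ (proj₂ isMeet) _ (Δv-mono w≤v w≤f₁ v≤p₁) (Δv-mono w≤v w≤f₂ v≤p₂)) m≤v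

      g∨e≡v : g ∨ e ≡ v
      g∨e≡v = ≤-antisym (∨-least g≤v e≤v)
        (meet-distrib e-isMeet y≤x∨y
          (≤-trans v≤p₁ (∨-least (≤-trans x≤x∨y y≤x∨y) x≤x∨y))
          (≤-trans v≤p₂ (∨-least (≤-trans x≤x∨y y≤x∨y) x≤x∨y)))

    shift-meet : m ∈ Shift L I g
    shift-meet = e , meetClosed f₁∈I f₂∈I e-isMeet ,
      subst (λ s → m ≡ Δ s e) (sym g∨e≡v) (sym (ax3 m v m≤v))

  shift-special : Special L (Shift L I g)
  shift-special = record
    { upClosed   = shift-upClosed
    ; implSub    = λ _ y∈ → shift-upClosed y∈ y≤x⇒y
    ; compatible = shift-compatible
    ; meetClosed = λ { (_ , f₁∈I , refl) (_ , f₂∈I , refl) isMeet → shift-meet f₁∈I f₂∈I isMeet }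
    }

  -- Equality of the generated subalgebras.

  ∨-mem-shift : f ∈ I → g ∨ f ∈ Shift L I g
  ∨-mem-shift f∈I = shift-upClosed (shift-mem f∈I) shift≤

  shift⊆⟦I⟧ : Shift L I g ⊆ ⟦ L ⟧ I
  shift⊆⟦I⟧ (_ , f∈I , refl) = delta (gen (∨-mem f∈I)) (gen f∈I)

  I⊆⟦shift⟧ : I ⊆ ⟦ L ⟧ (Shift L I g)
  -- Reflecting twice recovers `f`, and both arguments of the outer `Δ` lie in the shift.
  I⊆⟦shift⟧ f∈I = subst (_∈ ⟦ L ⟧ (Shift L I g)) shift-involutive
    (delta (gen (∨-mem-shift f∈I)) (gen (shift-mem f∈I)))

⟦⟧-least : ∀ {a : Level} {L : CubicAlgebra a} {X Y : Pred (CubicAlgebra.Carrier L) a} →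
  X ⊆ ⟦ L ⟧ Y → ⟦ L ⟧ X ⊆ ⟦ L ⟧ Y
⟦⟧-least X⊆ (gen x∈X)   = X⊆ x∈X
⟦⟧-least X⊆ top         = top
⟦⟧-least X⊆ (join p q)  = join (⟦⟧-least X⊆ p) (⟦⟧-least X⊆ q)
⟦⟧-least X⊆ (delta p q) = delta (⟦⟧-least X⊆ p) (⟦⟧-least X⊆ q)

theorem7p14 : ∀ {a : Level} (L : CubicAlgebra a) (I : Pred (CubicAlgebra.Carrier L) a) (g : CubicAlgebra.Carrier L) →
    Special L I →
    Special L (Shift L I g) × (⟦ L ⟧ (Shift L I g) ⊆ ⟦ L ⟧ I × ⟦ L ⟧ I ⊆ ⟦ L ⟧ (Shift L I g))
theorem7p14 L I g special = shift-special , ⟦⟧-least shift⊆⟦I⟧ , ⟦⟧-least I⊆⟦shift⟧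
  where open ShiftProperties L I g special
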